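{- If a step set $X\subseteq\mathbb{Z}^2\setminus\{O\}$ does not satisfy the Line Condition (LC) but does have the Bounded Paths Property (BPP), then $X$ has the Finite Paths Property (FPP).
   Context: Write $O=(0,0)$. A step set is any (finite or infinite) subset $X$ of $\mathbb{Z}^2\setminus\{O\}$. $\mathcal{F}_X$ is the free monoid on $X$ (all finite words over $X$, including the empty word), with $\ell(w)$ the length of a word $w$; $\mathcal{A}_X$ is the additive submonoid of $\mathbb{Z}^2$ generated by $X$; and $\alpha_X:\mathcal{F}_X\to\mathcal{A}_X$ is given by $\alpha_X(A_1\cdots A_k)=A_1+\cdots+A_k$. For $A\in\mathbb{Z}^2$ let $\Pi_X(A)=\{w\in\mathcal{F}_X:\alpha_X(w)=A\}$ and $\pi_X(A)=|\Pi_X(A)|$. $X$ has the FPP if $\pi_X(A)<\infty$ for all $A\in\mathcal{A}_X$. $X$ has the BPP if for every $A\in\mathcal{A}_X$ the set $\{\ell(w):w\in\Pi_X(A)\}$ is finite. $X$ satisfies the LC if it is contained in an open half-plane of $\mathbb{R}^2$ bounded by a line through $O$. -}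

module Defs where

open import Data.Integer as ℤ using (ℤ; 0ℤ)
open import Data.List using (List; []; _∷_; foldr; length)
import Data.List.Membership.Propositional as List
open import Data.List.Relation.Unary.All using (All; []; _∷_)
open import Data.Nat as ℕ using (ℕ)
import Data.Nat.Properties as ℕ
open import Data.Product using (_×_; _,_; ∃; ∃₂; zip)
open import Data.Rational as ℚ using (ℚ; 0ℚ; 1ℚ; ½; ∣_∣)
import Data.Rational.Properties as ℚ
open import Data.Rational.Solver using (module +-*-Solver)
open import Level using (Level)
open import Relation.Binary.PropositionalEquality
  using (_≡_; refl; sym; trans; cong; cong₂; subst)
open import Relation.Nullary using (¬_)
open import Relation.Unary using (Pred; _∈_; _∉_; _≐_)

private
  variable
    a ℓ : Level

------------------------------------------------------------------------
-- Real numbers, as Cauchy sequences of rationals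

Cauchy : (ℕ → ℚ) → Set
Cauchy x = ∀ ε → 0ℚ ℚ.< ε →
  ∃ λ N → ∀ m n → N ℕ.≤ m → N ℕ.≤ n → ∣ x m ℚ.- x n ∣ ℚ.< ε

record ℝ : Set where
  constructor mkℝ
  field
    seq    : ℕ → ℚ
    cauchy : Cauchy seq

open ℝ public

private abstract
  half-pos : ∀ {ε} → 0ℚ ℚ.< ε → 0ℚ ℚ.< ½ ℚ.* ε
  half-pos {ε} 0<ε = ℚ.positive⁻¹ (½ ℚ.* ε)
    {{ℚ.pos*pos⇒pos ½ ε {{ℚ.positive 0<ε}}}}

  halves : ∀ ε → ½ ℚ.* ε ℚ.+ ½ ℚ.* ε ≡ ε
  halves ε = trans (sym (ℚ.*-distribʳ-+ ε ½ ½)) (ℚ.*-identityˡ ε)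

  +-cauchy : ∀ {x y} → Cauchy x → Cauchy y → Cauchy (λ n → x n ℚ.+ y n)
  +-cauchy {x} {y} cx cy ε 0<ε
    with M , p ← cx (½ ℚ.* ε) (half-pos 0<ε)
       | N , q ← cy (½ ℚ.* ε) (half-pos 0<ε)
    = M ℕ.⊔ N , λ m n K≤m K≤n → begin-strict
      ∣ (x m ℚ.+ y m) ℚ.- (x n ℚ.+ y n) ∣
        ≡⟨ cong ∣_∣ (regroup (x m) (y m) (x n) (y n)) ⟩
      ∣ (x m ℚ.- x n) ℚ.+ (y m ℚ.- y n) ∣
        ≤⟨ ℚ.∣p+q∣≤∣p∣+∣q∣ (x m ℚ.- x n) (y m ℚ.- y n) ⟩
      ∣ x m ℚ.- x n ∣ ℚ.+ ∣ y m ℚ.- y n ∣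
        <⟨ ℚ.+-mono-< (p m n (ℕ.m⊔n≤o⇒m≤o M N K≤m) (ℕ.m⊔n≤o⇒m≤o M N K≤n))
                      (q m n (ℕ.m⊔n≤o⇒n≤o M N K≤m) (ℕ.m⊔n≤o⇒n≤o M N K≤n)) ⟩
      ½ ℚ.* ε ℚ.+ ½ ℚ.* ε
        ≡⟨ halves ε ⟩
      ε ∎
    where
    open ℚ.≤-Reasoning
    open +-*-Solver
    regroup : ∀ s t u v →
      (s ℚ.+ t) ℚ.- (u ℚ.+ v) ≡ (s ℚ.- u) ℚ.+ (t ℚ.- v)
    regroup = solve 4 (λ s t u v →
      (s :+ t) :- (u :+ v) := (s :- u) :+ (t :- v)) refl

  eventually-bounded : ∀ {x} → Cauchy x →
    ∃₂ λ N B → ℚ.Positive B × (∀ n → N ℕ.≤ n → ∣ x n ∣ ℚ.≤ B)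
  eventually-bounded {x} cx
    with N , p ← cx 1ℚ (ℚ.positive⁻¹ 1ℚ)
    = N , 1ℚ ℚ.+ ∣ x N ∣
    , ℚ.positive (ℚ.+-mono-<-≤ (ℚ.positive⁻¹ 1ℚ) (ℚ.0≤∣p∣ (x N)))
    , λ n N≤n → begin
      ∣ x n ∣                        ≡⟨ cong ∣_∣ (split (x n) (x N)) ⟩
      ∣ (x n ℚ.- x N) ℚ.+ x N ∣      ≤⟨ ℚ.∣p+q∣≤∣p∣+∣q∣ (x n ℚ.- x N) (x N) ⟩
      ∣ x n ℚ.- x N ∣ ℚ.+ ∣ x N ∣
        ≤⟨ ℚ.+-monoˡ-≤ ∣ x N ∣ (ℚ.<⇒≤ (p n N N≤n ℕ.≤-refl)) ⟩
      1ℚ ℚ.+ ∣ x N ∣                 ∎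
    where
    open ℚ.≤-Reasoning
    open +-*-Solver
    split : ∀ s t → s ≡ (s ℚ.- t) ℚ.+ t
    split = solve 2 (λ s t → s := (s :- t) :+ t) refl

  scaled : ∀ {x} → Cauchy x → ∀ B → ℚ.Positive B → ∀ ε → 0ℚ ℚ.< ε →
    ∃ λ N → ∀ m n → N ℕ.≤ m → N ℕ.≤ n → B ℚ.* ∣ x m ℚ.- x n ∣ ℚ.< ε
  scaled {x} cx B B>0 ε 0<ε =
    let B⁻¹ = (ℚ.1/ B) {{ℚ.pos⇒nonZero B {{B>0}}}}
        N , p = cx (B⁻¹ ℚ.* ε) (ℚ.positive⁻¹ (B⁻¹ ℚ.* ε)
          {{ℚ.pos*pos⇒pos B⁻¹ {{ℚ.1/pos⇒pos B {{B>0}}}} ε {{ℚ.positive 0<ε}}}})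
    in N , λ m n N≤m N≤n → begin-strict
      B ℚ.* ∣ x m ℚ.- x n ∣
        <⟨ ℚ.*-monoʳ-<-pos B {{B>0}} (p m n N≤m N≤n) ⟩
      B ℚ.* (B⁻¹ ℚ.* ε)
        ≡⟨ sym (ℚ.*-assoc B B⁻¹ ε) ⟩
      (B ℚ.* B⁻¹) ℚ.* ε
        ≡⟨ cong (ℚ._* ε) (ℚ.*-inverseʳ B {{ℚ.pos⇒nonZero B {{B>0}}}}) ⟩
      1ℚ ℚ.* ε
        ≡⟨ ℚ.*-identityˡ ε ⟩
      ε ∎
    where
    open ℚ.≤-Reasoning

  *-cauchy : ∀ {x y} → Cauchy x → Cauchy y → Cauchy (λ n → x n ℚ.* y n)
  *-cauchy {x} {y} cx cy ε 0<ε =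
    let M , B , B>0 , boundˣ = eventually-bounded {x} cx
        N , C , C>0 , boundʸ = eventually-bounded {y} cy
        M′ , p = scaled {x} cx C C>0 (½ ℚ.* ε) (half-pos 0<ε)
        N′ , q = scaled {y} cy B B>0 (½ ℚ.* ε) (half-pos 0<ε)
    in (M ℕ.⊔ N) ℕ.⊔ (M′ ℕ.⊔ N′) , λ m n K≤m K≤n →
      let M⊔N≤m = ℕ.m⊔n≤o⇒m≤o (M ℕ.⊔ N) (M′ ℕ.⊔ N′) K≤m
          M⊔N≤n = ℕ.m⊔n≤o⇒m≤o (M ℕ.⊔ N) (M′ ℕ.⊔ N′) K≤n
          M′⊔N′≤m = ℕ.m⊔n≤o⇒n≤o (M ℕ.⊔ N) (M′ ℕ.⊔ N′) K≤m
          M′⊔N′≤n = ℕ.m⊔n≤o⇒n≤o (M ℕ.⊔ N) (M′ ℕ.⊔ N′) K≤n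
      in estimate (x m) (y m) (x n) (y n) B C
        (boundʸ n (ℕ.m⊔n≤o⇒n≤o M N M⊔N≤n))
        (boundˣ m (ℕ.m⊔n≤o⇒m≤o M N M⊔N≤m))
        (p m n (ℕ.m⊔n≤o⇒m≤o M′ N′ M′⊔N′≤m) (ℕ.m⊔n≤o⇒m≤o M′ N′ M′⊔N′≤n))
        (q m n (ℕ.m⊔n≤o⇒n≤o M′ N′ M′⊔N′≤m) (ℕ.m⊔n≤o⇒n≤o M′ N′ M′⊔N′≤n))
    where
    open ℚ.≤-Reasoning
    open +-*-Solver
    ∣∣-nonNeg : ∀ s → ℚ.NonNegative ∣ s ∣
    ∣∣-nonNeg s = ℚ.nonNegative (ℚ.0≤∣p∣ s)
    regroup : ∀ s t u v →
      s ℚ.* t ℚ.- u ℚ.* v ≡ v ℚ.* (s ℚ.- u) ℚ.+ s ℚ.* (t ℚ.- v)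
    regroup = solve 4 (λ s t u v →
      s :* t :- u :* v := v :* (s :- u) :+ s :* (t :- v)) refl
    estimate : ∀ s t u v B C → ∣ v ∣ ℚ.≤ C → ∣ s ∣ ℚ.≤ B →
      C ℚ.* ∣ s ℚ.- u ∣ ℚ.< ½ ℚ.* ε → B ℚ.* ∣ t ℚ.- v ∣ ℚ.< ½ ℚ.* ε →
      ∣ s ℚ.* t ℚ.- u ℚ.* v ∣ ℚ.< ε
    estimate s t u v B C v≤C s≤B p q = begin-strict
      ∣ s ℚ.* t ℚ.- u ℚ.* v ∣
        ≡⟨ cong ∣_∣ (regroup s t u v) ⟩
      ∣ v ℚ.* (s ℚ.- u) ℚ.+ s ℚ.* (t ℚ.- v) ∣
        ≤⟨ ℚ.∣p+q∣≤∣p∣+∣q∣ (v ℚ.* (s ℚ.- u)) (s ℚ.* (t ℚ.- v)) ⟩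
      ∣ v ℚ.* (s ℚ.- u) ∣ ℚ.+ ∣ s ℚ.* (t ℚ.- v) ∣
        ≡⟨ cong₂ ℚ._+_ (ℚ.∣p*q∣≡∣p∣*∣q∣ v (s ℚ.- u))
                       (ℚ.∣p*q∣≡∣p∣*∣q∣ s (t ℚ.- v)) ⟩
      ∣ v ∣ ℚ.* ∣ s ℚ.- u ∣ ℚ.+ ∣ s ∣ ℚ.* ∣ t ℚ.- v ∣
        ≤⟨ ℚ.+-mono-≤
             (ℚ.*-monoʳ-≤-nonNeg ∣ s ℚ.- u ∣ {{∣∣-nonNeg (s ℚ.- u)}} v≤C)
             (ℚ.*-monoʳ-≤-nonNeg ∣ t ℚ.- v ∣ {{∣∣-nonNeg (t ℚ.- v)}} s≤B) ⟩
      C ℚ.* ∣ s ℚ.- u ∣ ℚ.+ B ℚ.* ∣ t ℚ.- v ∣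
        <⟨ ℚ.+-mono-< p q ⟩
      ½ ℚ.* ε ℚ.+ ½ ℚ.* ε
        ≡⟨ halves ε ⟩
      ε ∎

  const-cauchy : ∀ q → Cauchy (λ _ → q)
  const-cauchy q ε 0<ε = 0 , λ _ _ _ _ →
    subst (λ z → ∣ z ∣ ℚ.< ε) (sym (ℚ.+-inverseʳ q)) 0<ε

infixl 6 _+_
infixl 7 _*_
infix  4 _<_ _≈_

_+_ : ℝ → ℝ → ℝ
mkℝ x cx + mkℝ y cy = mkℝ (λ n → x n ℚ.+ y n) (+-cauchy {x} {y} cx cy)

_*_ : ℝ → ℝ → ℝ
mkℝ x cx * mkℝ y cy = mkℝ (λ n → x n ℚ.* y n) (*-cauchy {x} {y} cx cy)

fromℤ : ℤ → ℝ
fromℤ i = mkℝ (λ _ → i ℚ./ 1) (const-cauchy (i ℚ./ 1))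

0ℝ : ℝ
0ℝ = fromℤ 0ℤ

-- x < y requires the sequences to be eventually separated by a fixed
-- ε > 0; termwise strict inequality would also relate equal reals.
_<_ : ℝ → ℝ → Set
x < y = ∃ λ ε → 0ℚ ℚ.< ε ×
  ∃ λ N → ∀ n → N ℕ.≤ n → seq x n ℚ.+ ε ℚ.≤ seq y n

_≈_ : ℝ → ℝ → Set
x ≈ y = ∀ ε → 0ℚ ℚ.< ε →
  ∃ λ N → ∀ n → N ℕ.≤ n → ∣ seq x n ℚ.- seq y n ∣ ℚ.< ε

------------------------------------------------------------------------
-- The plane

ℤ² : Set
ℤ² = ℤ × ℤ

ℝ² : Set
ℝ² = ℝ × ℝ

O : ℤ²
O = 0ℤ , 0ℤ

infixl 6 _⊕_
_⊕_ : ℤ² → ℤ² → ℤ²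
_⊕_ = zip ℤ._+_ ℤ._+_

embed : ℤ² → ℝ²
embed (x , y) = fromℤ x , fromℤ y

-- The open half-planes bounded by a line through the origin are the sets
-- HalfPlane v with v nonzero: the bounding line is the set orthogonal to
-- v, and its other side is HalfPlane (- v).
HalfPlane : ℝ² → Pred ℝ² _
HalfPlane (a , b) (x , y) = 0ℝ < a * x + b * y

IsOrigin : ℝ² → Set
IsOrigin (a , b) = a ≈ 0ℝ × b ≈ 0ℝ

------------------------------------------------------------------------
-- Step sets and lattice paths

IsStepSet : Pred ℤ² ℓ → Set ℓ
IsStepSet X = O ∉ X

-- Words over X are lists of points all of whose letters lie in X, rather
-- than lists of pairs of a point and a membership proof, so that a word
-- is not counted once for each proof of membership.
𝓕 : Pred ℤ² ℓ → Pred (List ℤ²) ℓ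
𝓕 X = All X

α : List ℤ² → ℤ²
α = foldr _⊕_ O

data 𝓐 (X : Pred ℤ² ℓ) : Pred ℤ² ℓ where
  gen  : ∀ {A} → A ∈ X → A ∈ 𝓐 X
  zero : O ∈ 𝓐 X
  add  : ∀ {A B} → A ∈ 𝓐 X → B ∈ 𝓐 X → A ⊕ B ∈ 𝓐 X

α∈𝓐 : ∀ {X : Pred ℤ² ℓ} {w} → w ∈ 𝓕 X → α w ∈ 𝓐 X
α∈𝓐 []       = zero
α∈𝓐 (A ∷ As) = add (gen A) (α∈𝓐 As)

Π : Pred ℤ² ℓ → ℤ² → Pred (List ℤ²) ℓ
Π X A w = w ∈ 𝓕 X × α w ≡ A

Finite : {S : Set a} → Pred S ℓ → Set _
Finite P = ∃ λ xs → P ≐ (List._∈ xs)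

FPP : Pred ℤ² ℓ → Set ℓ
FPP X = ∀ A → A ∈ 𝓐 X → Finite (Π X A)

BPP : Pred ℤ² ℓ → Set ℓ
BPP X = ∀ A → A ∈ 𝓐 X → Finite λ k → ∃ λ w → w ∈ Π X A × length w ≡ k

LC : Pred ℤ² ℓ → Set ℓ
LC X = ∃ λ v → ¬ IsOrigin v × (∀ {A} → A ∈ X → embed A ∈ HalfPlane v)

{-# OPTIONS --safe #-}
-- If some a ∈ X lies on the boundary of a closed half-plane {b · x ≥ 0}
-- containing X, then BPP forces FPP.  Among the points of X with a given value
-- of b · x and a given residue of a · x mod a · a, any two differ by a multiple
-- of a; were a · x unbounded below among them, appending ever more letters a
-- would give arbitrarily long words for one fixed point.  So the letters of the
-- words for A are bounded in both coordinates, and these words bounded in length.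
--
-- Otherwise fix a ∈ X and put p(x) = a · x and q(x) = det(a, x).  By BPP no
-- nonempty word sums to O, which makes the slopes p/q of the points with q < 0
-- smaller than those of the points with q > 0.  For a real r between the two sets
-- of slopes, p - r q ≥ 0 on X; a zero of it in X would lie on the boundary of a
-- closed half-plane containing X, so p - r q > 0 on X and LC holds.
module Submission where

open import Defs hiding (_+_; _*_; _<_)
import Defs as ℝ
open import Axiom.ExcludedMiddle using (ExcludedMiddle)
open import Relation.Nullary using (¬_; yes; no; contradiction)
open import Relation.Nullary.Decidable using (decidable-stable)
open import Relation.Unary using (Pred; _∈_; _∉_)

open import Data.Integer
  using (ℤ; +_; -[1+_]; +[1+_]; +0; 0ℤ; _+_; _*_; _-_; -_; _≤_; _<_; +≤+; -≤+; -≤-; +<+; ∣_∣)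
import Data.Integer as ℤ
open import Data.Integer.DivMod using (_%ℕ_; _/ℕ_; a≡a%ℕn+[a/ℕn]*n; n%ℕd<d)
import Data.Integer.Properties as ℤ
open import Data.Integer.Tactic.RingSolver using (solve-∀)
open import Data.List
  using (List; []; _∷_; _++_; map; filter; length; replicate; upTo; foldr;
         cartesianProduct; cartesianProductWith)
import Data.List.Extrema.Nat as Extrema
import Data.List.Membership.Propositional as List
open import Data.List.Membership.Propositional.Properties
  using (∈-filter⁺; ∈-filter⁻; ∈-map⁺; ∈-++⁺ˡ; ∈-++⁺ʳ; ∈-upTo⁺;
         ∈-cartesianProduct⁺; ∈-cartesianProductWith⁺)
open import Data.List.Properties using (length-++; length-replicate)
open import Data.List.Relation.Unary.All as All using (All; []; _∷_)
import Data.List.Relation.Unary.All.Properties as All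
open import Data.List.Relation.Unary.Any using (here; there)
open import Data.Nat as ℕ using (ℕ; suc; z≤n; s≤s)
import Data.Nat.Coprimality as Coprimality
import Data.Nat.Properties as ℕ
open import Data.Product using (_×_; _,_; ∃; proj₁; proj₂)
open import Data.Rational as ℚ using (ℚ; mkℚ; 0ℚ; 1ℚ; 1/_)
import Data.Rational.Properties as ℚ
open import Data.Rational.Solver using (module +-*-Solver)
open import Data.Sum using (_⊎_; inj₁; inj₂)
open import Level using (Level)
open import Relation.Binary.Definitions using (Tri; tri<; tri≈; tri>)
open import Relation.Binary.PropositionalEquality
  using (_≡_; _≢_; refl; sym; trans; cong; cong₂; subst; subst₂; module ≡-Reasoning)

private
  variable
    a ℓ : Level

-- Finite sets and uniform bounds

finite-⊆ : ExcludedMiddle ℓ → {S : Set a} {P : Pred S ℓ} (xs : List S) →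
  (∀ {x} → x ∈ P → x List.∈ xs) → Finite P
finite-⊆ em {P = P} xs P⊆xs =
    -- `Finite` asks for a list of exactly the members, so the other entries of `xs` are removed,
    -- with excluded middle as decision procedure.
    filter P? xs
  , (λ p → ∈-filter⁺ P? (P⊆xs p) p)
  , (λ i → proj₂ (∈-filter⁻ P? {xs = xs} i))
  where P? = λ x → em {P x}

finite-bounded : {P : Pred ℕ ℓ} → Finite P → ∃ λ L → ∀ {n} → n ∈ P → n ℕ.≤ L
finite-bounded (xs , P⊆xs , _) =
  Extrema.max 0 xs , λ p → All.lookup (Extrema.xs≤max 0 xs) (P⊆xs p)

-- Finitely many bounds have a maximum, and monotonicity raises each of them to it. It serves for
-- the residues modulo `N` and for the values of `dot b`.
uniform-bound : {P : ℕ → ℕ → Set ℓ} → (∀ {i C C′} → C ℕ.≤ C′ → P i C → P i C′) →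
  (∀ i → ∃ (P i)) → ∀ n → ∃ λ C → ∀ {i} → i ℕ.< n → P i C
uniform-bound mono bound ℕ.zero = 0 , λ ()
uniform-bound {P = P} mono bound (suc n)
  with C , below ← uniform-bound {P = P} mono bound n | C′ , at ← bound n
  = C ℕ.⊔ C′ , λ i<1+n → extend (ℕ.m<1+n⇒m<n∨m≡n i<1+n)
  where
  extend : ∀ {i} → i ℕ.< n ⊎ i ≡ n → P i (C ℕ.⊔ C′)
  extend (inj₁ i<n)  = mono (ℕ.m≤m⊔n C C′) (below i<n)
  extend (inj₂ refl) = mono (ℕ.m≤n⊔m C C′) at

-- Linear algebra in the plane

infixr 7 _·_
_·_ : ℤ → ℤ² → ℤ²
k · (x , y) = k * x , k * y

dot det : ℤ² → ℤ² → ℤ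
dot (a , b) (x , y) = a * x + b * y
det (a , b) (x , y) = a * y - b * x

dot-⊕ : ∀ a x y → dot a (x ⊕ y) ≡ dot a x + dot a y
dot-⊕ (a , b) (x , y) (u , v) = expand a b x y u v
  where
  expand : ∀ a b x y u v →
    a * (x + u) + b * (y + v) ≡ (a * x + b * y) + (a * u + b * v)
  expand = solve-∀

dot-· : ∀ a k x → dot a (k · x) ≡ k * dot a x
dot-· (a , b) k (x , y) = expand a b k x y
  where
  expand : ∀ a b k x y → a * (k * x) + b * (k * y) ≡ k * (a * x + b * y)
  expand = solve-∀

dot-O : ∀ a → dot a O ≡ 0ℤ
dot-O (a , b) = cong₂ _+_ (ℤ.*-zeroʳ a) (ℤ.*-zeroʳ b)

0<dot-self : ∀ a → a ≢ O → 0ℤ < dot a a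
0<dot-self (+0       , +0      ) a≢O = contradiction refl a≢O
0<dot-self (+0       , +[1+ n ]) _ = +<+ (s≤s z≤n)
0<dot-self (+0       , -[1+ n ]) _ = +<+ (s≤s z≤n)
0<dot-self (+[1+ m ] , +0      ) _ = +<+ (s≤s z≤n)
0<dot-self (+[1+ m ] , +[1+ n ]) _ = +<+ (s≤s z≤n)
0<dot-self (+[1+ m ] , -[1+ n ]) _ = +<+ (s≤s z≤n)
0<dot-self (-[1+ m ] , +0      ) _ = +<+ (s≤s z≤n)
0<dot-self (-[1+ m ] , +[1+ n ]) _ = +<+ (s≤s z≤n)
0<dot-self (-[1+ m ] , -[1+ n ]) _ = +<+ (s≤s z≤n)

-- Cramer's rule without division. It is used twice: the values of two independent forms determine a
-- point, and bounds on them bound its coordinates.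
cramer₁ : ∀ a b x →
  det a b * proj₁ x ≡ dot a x * proj₂ b - dot b x * proj₂ a
cramer₁ (a , b) (c , d) (x , y) = expand a b c d x y
  where
  expand : ∀ a b c d x y →
    (a * d - b * c) * x ≡ (a * x + b * y) * d - (c * x + d * y) * b
  expand = solve-∀

cramer₂ : ∀ a b x →
  det a b * proj₂ x ≡ dot b x * proj₁ a - dot a x * proj₁ b
cramer₂ (a , b) (c , d) (x , y) = expand a b c d x y
  where
  expand : ∀ a b c d x y →
    (a * d - b * c) * y ≡ (c * x + d * y) * a - (a * x + b * y) * c
  expand = solve-∀

dot-injective : ∀ a b {x y} → det a b ≢ 0ℤ →
  dot a x ≡ dot a y → dot b x ≡ dot b y → x ≡ y
dot-injective a b {x} {y} det≢0 p≡ q≡ = cong₂ _,_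
  (cancel (trans (cramer₁ a b x) (trans
    (cong₂ (λ p q → p * proj₂ b - q * proj₂ a) p≡ q≡) (sym (cramer₁ a b y)))))
  (cancel (trans (cramer₂ a b x) (trans
    (cong₂ (λ p q → q * proj₁ a - p * proj₁ b) p≡ q≡) (sym (cramer₂ a b y)))))
  where
  cancel : ∀ {i j} → det a b * i ≡ det a b * j → i ≡ j
  cancel = ℤ.*-cancelˡ-≡ (det a b) _ _ {{ℤ.≢-nonZero det≢0}}

-- Words

α-++ : ∀ u v → α (u ++ v) ≡ α u ⊕ α v
α-++ []      v = cong₂ _,_ (sym (ℤ.+-identityˡ _)) (sym (ℤ.+-identityˡ _))
α-++ (x ∷ u) v = trans (cong (x ⊕_) (α-++ u v))
  (cong₂ _,_ (sym (ℤ.+-assoc (proj₁ x) _ _)) (sym (ℤ.+-assoc (proj₂ x) _ _)))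

α-replicate : ∀ n x → α (replicate n x) ≡ + n · x
α-replicate ℕ.zero  x = refl
α-replicate (suc n) x = trans (cong (x ⊕_) (α-replicate n x))
  (cong₂ _,_ (sym (ℤ.suc-* (+ n) (proj₁ x))) (sym (ℤ.suc-* (+ n) (proj₂ x))))

-- Consequences of bounded path lengths

module _ {X : Pred ℤ² ℓ} (bpp : BPP X) where

  length-bound : ∀ {A} → A ∈ 𝓐 X → ∃ λ L → ∀ {w} → w ∈ Π X A → length w ℕ.≤ L
  length-bound A∈𝓐 with L , bound ← finite-bounded (bpp _ A∈𝓐) =
    L , λ w∈Π → bound (_ , w∈Π , refl)

  zero-sum-empty : ∀ {w} → w ∈ Π X O → w ≡ []
  zero-sum-empty {[]}    _ = refl
  zero-sum-empty {w@(_ ∷ _)} (w∈𝓕 , αw≡O) with L , bound ← length-bound zero =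
    -- As `w` is nonempty, its `suc L`-fold repetition is longer than `L`.
    let u , u∈Π , |u|≡ = power (suc L)
    in contradiction
         (ℕ.≤-trans (ℕ.m≤m*n (suc L) (length w)) (subst (ℕ._≤ L) |u|≡ (bound u∈Π)))
         (ℕ.<-irrefl refl)
    where
    power : ∀ n → ∃ λ u → u ∈ Π X O × length u ≡ n ℕ.* length w
    power ℕ.zero = [] , ([] , refl) , refl
    power (suc n) with u , (u∈𝓕 , αu≡O) , |u|≡ ← power n
      = w ++ u
      , (All.++⁺ w∈𝓕 u∈𝓕 , trans (α-++ w u) (cong₂ _⊕_ αw≡O αu≡O))
      , trans (length-++ w) (cong (length w ℕ.+_) |u|≡)

  -- The word of `i` letters `x`, `j` letters `y` and `k` letters `z` would sum to `O`, and it is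
  -- nonempty since `i` is positive.
  no-zero-sum : ∀ {x y z i j k} → x ∈ X → y ∈ X → z ∈ X → 0ℤ < i → 0ℤ ≤ j → 0ℤ ≤ k →
    i · x ⊕ (j · y ⊕ k · z) ≢ O
  no-zero-sum {x} {y} {z} {+[1+ i ]} {+ j} {+ k} x∈X y∈X z∈X (+<+ _) (+≤+ _) (+≤+ _) sum≡O
    = contradiction (zero-sum-empty
        ( All.++⁺ (All.replicate⁺ (suc i) x∈X)
            (All.++⁺ (All.replicate⁺ j y∈X) (All.replicate⁺ k z∈X))
        , trans (trans (α-++ (replicate (suc i) x) _) (cong₂ _⊕_ (α-replicate (suc i) x)
            (trans (α-++ (replicate j y) _) (cong₂ _⊕_ (α-replicate j y) (α-replicate k z)))))
            sum≡O))
        λ ()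

-- Enumeration of short words with letters in a box

integers : ℕ → List ℤ
integers M = map +_ (upTo (suc M)) ++ map -[1+_] (upTo M)

∈-integers : ∀ {M} i → ∣ i ∣ ℕ.≤ M → i List.∈ integers M
∈-integers (+ n)    n≤M = ∈-++⁺ˡ (∈-map⁺ +_ (∈-upTo⁺ (s≤s n≤M)))
∈-integers {M} -[1+ n ] n<M = ∈-++⁺ʳ (map +_ (upTo (suc M))) (∈-map⁺ -[1+_] (∈-upTo⁺ n<M))

box : ℕ → List ℤ²
box M = cartesianProduct (integers M) (integers M)

words : ∀ {S : Set a} → List S → ℕ → List (List S)
words xs ℕ.zero  = [] ∷ []
words xs (suc n) = [] ∷ cartesianProductWith _∷_ xs (words xs n)

∈-words : ∀ {S : Set a} {xs : List S} {w n} → All (List._∈ xs) w → length w ℕ.≤ n →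
  w List.∈ words xs n
∈-words {n = ℕ.zero} [] _ = here refl
∈-words {n = suc n}  [] _ = here refl
∈-words (x∈ ∷ w∈) (s≤s |w|≤n) = there (∈-cartesianProductWith⁺ _∷_ x∈ (∈-words w∈ |w|≤n))

sum : List ℤ → ℤ
sum = foldr _+_ 0ℤ

-- Adding `C` to each letter's value turns a lower bound `- C` into nonnegativity, so that
-- `terms≤sum` applies; the cost in the total is only `length w * C`.
sum-map-dot : ∀ a C w → sum (map (λ x → dot a x + C) w) ≡ dot a (α w) + + length w * C
sum-map-dot a C []      = sym (trans (ℤ.+-identityʳ (dot a O)) (dot-O a))
sum-map-dot a C (x ∷ w) = begin
  dot a x + C + sum (map (λ x → dot a x + C) w)
    ≡⟨ cong (_+_ (dot a x + C)) (sum-map-dot a C w) ⟩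
  dot a x + C + (dot a (α w) + + length w * C)
    ≡⟨ regroup (dot a x) C (dot a (α w)) (+ length w * C) ⟩
  dot a x + dot a (α w) + (C + + length w * C)
    ≡⟨ cong₂ _+_ (sym (dot-⊕ a x (α w))) (sym (ℤ.suc-* (+ length w) C)) ⟩
  dot a (α (x ∷ w)) + + suc (length w) * C ∎
  where
  open ≡-Reasoning
  regroup : ∀ p C s l → p + C + (s + l) ≡ p + s + (C + l)
  regroup = solve-∀

module _ {S : Set a} {f : S → ℤ} where

  0≤sum : ∀ {w} → All (λ x → 0ℤ ≤ f x) w → 0ℤ ≤ sum (map f w)
  0≤sum []           = ℤ.≤-refl
  0≤sum (0≤fx ∷ 0≤fw) = ℤ.+-mono-≤ 0≤fx (0≤sum 0≤fw)

  terms≤sum : ∀ {w} → All (λ x → 0ℤ ≤ f x) w → All (λ x → f x ≤ sum (map f w)) w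
  terms≤sum [] = []
  terms≤sum {x ∷ w} (0≤fx ∷ 0≤fw) =
      subst (_≤ f x + sum (map f w)) (ℤ.+-identityʳ (f x)) (ℤ.+-monoʳ-≤ (f x) (0≤sum 0≤fw))
    ∷ All.map (λ fy≤ → ℤ.≤-trans fy≤
        (subst (_≤ f x + sum (map f w)) (ℤ.+-identityˡ _) (ℤ.+-monoˡ-≤ (sum (map f w)) 0≤fx)))
        (terms≤sum 0≤fw)

∣∣-bound : ∀ {C i j} → - + C ≤ i → i ≤ j → ∣ i ∣ ℕ.≤ C ℕ.+ ∣ j ∣
∣∣-bound {C} {+ m} {+ n} _ (+≤+ m≤n) = ℕ.≤-trans m≤n (ℕ.m≤n+m n C)
∣∣-bound {suc C} { -[1+ m ]} {j} (-≤- m≤C) _ = ℕ.≤-trans (s≤s m≤C) (ℕ.m≤m+n (suc C) ∣ j ∣)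

-∣i∣≤i : ∀ i → - + ∣ i ∣ ≤ i
-∣i∣≤i (+ n)    = ℤ.≤-trans (ℤ.neg-≤-pos {n} {0}) (+≤+ z≤n)
-∣i∣≤i -[1+ n ] = ℤ.≤-refl

-- A nonzero integer `D` has absolute value at least 1, so a bound on `D * x` already bounds `x`.
cramer-bound : ∀ {P Q} D x p q b c → D ≢ 0ℤ → D * x ≡ p * b - q * c →
  ∣ p ∣ ℕ.≤ P → ∣ q ∣ ℕ.≤ Q → ∣ x ∣ ℕ.≤ P ℕ.* ∣ b ∣ ℕ.+ Q ℕ.* ∣ c ∣
cramer-bound {P} {Q} D x p q b c D≢0 eq p≤P q≤Q = begin
  ∣ x ∣                               ≤⟨ ℕ.m≤n*m ∣ x ∣ ∣ D ∣ {{ℤ.≢-nonZero D≢0}} ⟩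
  ∣ D ∣ ℕ.* ∣ x ∣                     ≡⟨ ℤ.abs-* D x ⟨
  ∣ D * x ∣                           ≡⟨ cong ∣_∣ eq ⟩
  ∣ p * b - q * c ∣                   ≤⟨ ℤ.∣i-j∣≤∣i∣+∣j∣ (p * b) (q * c) ⟩
  ∣ p * b ∣ ℕ.+ ∣ q * c ∣             ≡⟨ cong₂ ℕ._+_ (ℤ.abs-* p b) (ℤ.abs-* q c) ⟩
  ∣ p ∣ ℕ.* ∣ b ∣ ℕ.+ ∣ q ∣ ℕ.* ∣ c ∣ ≤⟨ ℕ.+-mono-≤ (ℕ.*-monoˡ-≤ ∣ b ∣ p≤P) (ℕ.*-monoˡ-≤ ∣ c ∣ q≤Q) ⟩
  P ℕ.* ∣ b ∣ ℕ.+ Q ℕ.* ∣ c ∣         ∎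
  where open ℕ.≤-Reasoning

radius : ℤ² → ℤ² → ℕ → ℕ → ℕ
radius (a , b) (c , d) P Q = (P ℕ.* ∣ d ∣ ℕ.+ Q ℕ.* ∣ b ∣) ℕ.+ (Q ℕ.* ∣ a ∣ ℕ.+ P ℕ.* ∣ c ∣)

∈-box : ∀ a b P Q {x} → det a b ≢ 0ℤ → ∣ dot a x ∣ ℕ.≤ P → ∣ dot b x ∣ ℕ.≤ Q →
  x List.∈ box (radius a b P Q)
∈-box a b P Q {x} det≢0 p≤P q≤Q = ∈-cartesianProduct⁺
  (∈-integers {radius a b P Q} (proj₁ x) (ℕ.≤-trans
    (cramer-bound (det a b) _ (dot a x) (dot b x) (proj₂ b) (proj₂ a) det≢0 (cramer₁ a b x) p≤P q≤Q)
    (ℕ.m≤m+n _ _)))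
  (∈-integers {radius a b P Q} (proj₂ x) (ℕ.≤-trans
    (cramer-bound (det a b) _ (dot b x) (dot a x) (proj₁ a) (proj₁ b) det≢0 (cramer₂ a b x) q≤Q p≤P)
    (ℕ.m≤n+m _ (P ℕ.* ∣ proj₂ b ∣ ℕ.+ Q ℕ.* ∣ proj₂ a ∣))))

-- The case of a supporting line through a point of `X`

module SupportingLine (em : ExcludedMiddle ℓ) {X : Pred ℤ² ℓ} (bpp : BPP X)
  {a b : ℤ²} (a∈X : a ∈ X) (b⊥a : dot b a ≡ 0ℤ) (det≢0 : det a b ≢ 0ℤ)
  (0≤b : ∀ {x} → x ∈ X → 0ℤ ≤ dot b x) where

  N : ℕ
  N = ∣ dot a a ∣

  0<N : 0ℤ < dot a a
  0<N = 0<dot-self a λ { refl → det≢0 refl }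

  +N≡ : + N ≡ dot a a
  +N≡ = ℤ.0≤i⇒+∣i∣≡i (ℤ.<⇒≤ 0<N)

  instance
    N≢0 : ℕ.NonZero N
    N≢0 = ℤ.≢-nonZero (λ N≡0 → ℤ.<-irrefl (sym N≡0) 0<N)

  Class : ℕ → ℕ → ℤ² → Set
  Class q r x = dot b x ≡ + q × dot a x %ℕ N ≡ r

  -- Any `x` in the class reaches a fixed member `x₀` by adding `steps x` copies of `a`. This number
  -- is at most the length bound `L` for words of `x₀`, so `dot a x` is at least `dot a x₀ - L * N`.
  -- An empty class admits any bound.
  class-bounded : ∀ q r → ∃ λ C → ∀ {x} → x ∈ X → Class q r x → - + C ≤ dot a x
  class-bounded q r with em {∃ λ x → x ∈ X × Class q r x}
  ... | no ∄x = 0 , λ x∈X x∈c → contradiction (_ , x∈X , x∈c) ∄x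
  ... | yes (x₀ , x₀∈X , q₀ , r₀) with L , bound ← length-bound bpp (gen x₀∈X) =
    ∣ dot a x₀ ∣ ℕ.+ L ℕ.* N , λ {x} → below {x}
    where
    steps : ℤ² → ℤ
    steps x = dot a x₀ /ℕ N - dot a x /ℕ N

    p₀≡ : ∀ {x} → Class q r x → dot a x₀ ≡ dot a x + steps x * + N
    p₀≡ {x} (_ , r₁) = begin
      dot a x₀                              ≡⟨ a≡a%ℕn+[a/ℕn]*n (dot a x₀) N ⟩
      + (dot a x₀ %ℕ N) + k₀ * + N          ≡⟨ cong (λ s → + s + k₀ * + N) (trans r₀ (sym r₁)) ⟩
      + (dot a x %ℕ N) + k₀ * + N           ≡⟨ regroup (+ (dot a x %ℕ N)) k₀ k (+ N) ⟩
      + (dot a x %ℕ N) + k * + N + steps x * + N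
        ≡⟨ cong (_+ steps x * + N) (a≡a%ℕn+[a/ℕn]*n (dot a x) N) ⟨
      dot a x + steps x * + N               ∎
      where
      open ≡-Reasoning
      k₀ = dot a x₀ /ℕ N
      k  = dot a x /ℕ N
      regroup : ∀ r k₀ k n → r + k₀ * n ≡ r + k * n + (k₀ - k) * n
      regroup = solve-∀

    -- Both forms agree on the two points: `dot a` by `p₀≡`, `dot b` because `b` is orthogonal to
    -- `a`.
    x₀≡ : ∀ {x} → Class q r x → x ⊕ steps x · a ≡ x₀
    x₀≡ {x} x∈c@(q₁ , _) = dot-injective a b det≢0
      (begin
        dot a (x ⊕ steps x · a)         ≡⟨ dot-⊕ a x (steps x · a) ⟩
        dot a x + dot a (steps x · a)   ≡⟨ cong (_+_ (dot a x)) (dot-· a (steps x) a) ⟩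
        dot a x + steps x * dot a a     ≡⟨ cong (λ n → dot a x + steps x * n) +N≡ ⟨
        dot a x + steps x * + N         ≡⟨ p₀≡ x∈c ⟨
        dot a x₀                        ∎)
      (begin
        dot b (x ⊕ steps x · a)         ≡⟨ dot-⊕ b x (steps x · a) ⟩
        dot b x + dot b (steps x · a)   ≡⟨ cong (_+_ (dot b x)) (dot-· b (steps x) a) ⟩
        dot b x + steps x * dot b a     ≡⟨ cong (λ n → dot b x + steps x * n) b⊥a ⟩
        dot b x + steps x * 0ℤ          ≡⟨ cong (λ n → dot b x + n) (ℤ.*-zeroʳ (steps x)) ⟩
        dot b x + 0ℤ                    ≡⟨ ℤ.+-identityʳ (dot b x) ⟩
        dot b x                         ≡⟨ trans q₁ (sym q₀) ⟩
        dot b x₀                        ∎)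
      where open ≡-Reasoning

    -- Stated for arbitrary `t` so that its sign can be inspected. For `t` nonnegative, `x` followed
    -- by `t` copies of `a` is a word of length `suc t` for `x₀`.
    steps≤L : ∀ {x} → x ∈ X → ∀ t → x ⊕ t · a ≡ x₀ → t ≤ + L
    steps≤L x∈X -[1+ _ ] _  = -≤+
    steps≤L {x} x∈X (+ t) eq = +≤+ (ℕ.≤-trans (ℕ.n≤1+n t) (subst (λ n → suc n ℕ.≤ L)
      (length-replicate t)
      (bound {x ∷ replicate t a}
        (x∈X ∷ All.replicate⁺ t a∈X , trans (cong (x ⊕_) (α-replicate t a)) eq))))

    below : ∀ {x} → x ∈ X → Class q r x → - + (∣ dot a x₀ ∣ ℕ.+ L ℕ.* N) ≤ dot a x
    below {x} x∈X x∈c = begin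
      - + (∣ dot a x₀ ∣ ℕ.+ L ℕ.* N)     ≡⟨ ℤ.neg-distrib-+ (+ ∣ dot a x₀ ∣) (+ (L ℕ.* N)) ⟩
      - + ∣ dot a x₀ ∣ - + (L ℕ.* N)     ≡⟨ cong (λ n → - + ∣ dot a x₀ ∣ - n) (ℤ.pos-* L N) ⟩
      - + ∣ dot a x₀ ∣ - + L * + N
        ≤⟨ ℤ.+-mono-≤ (-∣i∣≤i (dot a x₀)) (ℤ.neg-mono-≤
             (ℤ.*-monoʳ-≤-nonNeg (+ N) (steps≤L x∈X (steps x) (x₀≡ x∈c)))) ⟩
      dot a x₀ - steps x * + N           ≡⟨ cong (λ p → p - steps x * + N) (p₀≡ x∈c) ⟩
      dot a x + steps x * + N - steps x * + N ≡⟨ cancel (dot a x) (steps x * + N) ⟩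
      dot a x                            ∎
      where
      open ℤ.≤-Reasoning
      cancel : ∀ p s → p + s - s ≡ p
      cancel = solve-∀

  weaken : ∀ {C C′ i} → C ℕ.≤ C′ → - + C ≤ i → - + C′ ≤ i
  weaken C≤C′ = ℤ.≤-trans (ℤ.neg-mono-≤ (+≤+ C≤C′))

  -- The strip is a finite union of classes: `dot b x` is one of `0` to `Q` by `0≤b`, and there are
  -- `N` residues.
  strip-bounded : ∀ Q → ∃ λ C → ∀ {x} → x ∈ X → dot b x ≤ + Q → - + C ≤ dot a x
  strip-bounded Q =
    let C , below = uniform-bound {P = λ q C → ∀ {x} → x ∈ X → dot b x ≡ + q → - + C ≤ dot a x}
          (λ C≤C′ h x∈X q≡ → weaken C≤C′ (h x∈X q≡))
          (λ q →
            let C , below = uniform-bound {P = λ r C → ∀ {x} → x ∈ X → Class q r x → - + C ≤ dot a x}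
                  (λ C≤C′ h x∈X c → weaken C≤C′ (h x∈X c)) (class-bounded q) N
            in C , λ {x} x∈X q≡ → below (n%ℕd<d (dot a x) N) x∈X (q≡ , refl))
          (suc Q)
    in C , λ {x} x∈X q≤Q →
      let q≡ = ℤ.0≤i⇒+∣i∣≡i (0≤b x∈X)
      in below {∣ dot b x ∣} (s≤s (ℤ.drop‿+≤+ (subst (_≤ + Q) (sym q≡) q≤Q))) x∈X (sym q≡)

  fpp : FPP X
  fpp A A∈𝓐 =
    let L , short = length-bound bpp A∈𝓐
        C , below = strip-bounded ∣ dot b A ∣
        -- The upper bound of `p-bounds` plus the `C` of the lower bound, as `∣∣-bound` delivers it.
        P = C ℕ.+ (∣ dot a A ∣ ℕ.+ L ℕ.* C)
        Q = ∣ dot b A ∣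
    in finite-⊆ em (words (box (radius a b P Q)) L) λ {w} (w∈𝓕 , αw≡A) →
      -- The values `dot b x` are nonnegative and add up to `dot b A`, so none exceeds it. The
      -- summand `0ℤ` fits the shape of `sum-map-dot`.
      let q-bounds : All (λ x → dot b x ≤ + Q) w
          q-bounds = All.map (λ {x} → λ q≤ → begin
              dot b x                          ≡⟨ ℤ.+-identityʳ (dot b x) ⟨
              dot b x + 0ℤ                     ≤⟨ q≤ ⟩
              sum (map (λ x → dot b x + 0ℤ) w) ≡⟨ sum-map-dot b 0ℤ w ⟩
              dot b (α w) + + length w * 0ℤ    ≡⟨ cong₂ _+_ (cong (dot b) αw≡A) (ℤ.*-zeroʳ (+ length w)) ⟩
              dot b A + 0ℤ                     ≡⟨ ℤ.+-identityʳ (dot b A) ⟩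
              dot b A                          ≤⟨ i≤∣i∣ (dot b A) ⟩
              + Q                              ∎)
            (terms≤sum {f = λ x → dot b x + 0ℤ} (All.map (λ {x} x∈X →
              subst (0ℤ ≤_) (sym (ℤ.+-identityʳ (dot b x))) (0≤b x∈X)) w∈𝓕))
          -C≤p : All (λ x → - + C ≤ dot a x) w
          -C≤p = All.map (λ (x∈X , q≤Q) → below x∈X q≤Q) (All.zip (w∈𝓕 , q-bounds))
          -- After the shift by `C` the values of `dot a` are nonnegative with sum
          -- `dot a A + length w * C`, and `L` bounds the length.
          p-bounds : All (λ x → dot a x ≤ + (∣ dot a A ∣ ℕ.+ L ℕ.* C)) w
          p-bounds = All.map (λ {x} → λ p≤ → begin
              dot a x                            ≤⟨ ℤ.i≤i+j (dot a x) (+ C) ⟩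
              dot a x + + C                      ≤⟨ p≤ ⟩
              sum (map (λ x → dot a x + + C) w)  ≡⟨ sum-map-dot a (+ C) w ⟩
              dot a (α w) + + length w * + C     ≡⟨ cong (λ B → dot a B + + length w * + C) αw≡A ⟩
              dot a A + + length w * + C
                ≤⟨ ℤ.+-mono-≤ (i≤∣i∣ (dot a A))
                     (ℤ.*-monoʳ-≤-nonNeg (+ C) (+≤+ (short (w∈𝓕 , αw≡A)))) ⟩
              + ∣ dot a A ∣ + + L * + C          ≡⟨ cong (_+_ (+ ∣ dot a A ∣)) (ℤ.pos-* L C) ⟨
              + (∣ dot a A ∣ ℕ.+ L ℕ.* C)        ∎)
            (terms≤sum {f = λ x → dot a x + + C} (All.map (λ {x} -C≤ →
              subst (_≤ dot a x + + C) (ℤ.+-inverseˡ (+ C)) (ℤ.+-monoˡ-≤ (+ C) -C≤)) -C≤p))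
      in ∈-words (All.map (λ {x} (x∈X , q≤Q , -C≤p , p≤P) →
           ∈-box a b P Q {x} det≢0 (∣∣-bound -C≤p p≤P)
             (ℤ.drop‿+≤+ (subst (_≤ + Q) (sym (ℤ.0≤i⇒+∣i∣≡i (0≤b x∈X))) q≤Q)))
           (All.zip (w∈𝓕 , All.zip (q-bounds , All.zip (-C≤p , p-bounds)))))
         (short (w∈𝓕 , αw≡A))
    where
    open ℤ.≤-Reasoning
    i≤∣i∣ : ∀ i → i ≤ + ∣ i ∣
    i≤∣i∣ (+ n)    = ℤ.≤-refl
    i≤∣i∣ -[1+ n ] = -≤+

-- Rationals

ι : ℤ → ℚ
ι i = i ℚ./ 1

-- `i ℚ./ 1` does not reduce for a variable `i`; the `mkℚ` form does compute under the operations
-- and the order of `ℚ`.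
ι≡mkℚ : ∀ i → ι i ≡ mkℚ i 0 (Coprimality.sym (Coprimality.1-coprimeTo ∣ i ∣))
ι≡mkℚ i = ℚ.↥p/↧p≡p (mkℚ i 0 (Coprimality.sym (Coprimality.1-coprimeTo ∣ i ∣)))

ι-+ : ∀ i j → ι (i + j) ≡ ι i ℚ.+ ι j
ι-+ i j = sym (trans (cong₂ ℚ._+_ (ι≡mkℚ i) (ι≡mkℚ j))
  (cong ι (cong₂ _+_ (ℤ.*-identityʳ i) (ℤ.*-identityʳ j))))

ι-* : ∀ i j → ι (i * j) ≡ ι i ℚ.* ι j
ι-* i j = sym (cong₂ ℚ._*_ (ι≡mkℚ i) (ι≡mkℚ j))

ι-neg : ∀ i → ι (- i) ≡ ℚ.- ι i
ι-neg i = trans (cong ι (sym (ℤ.-1*i≡-i i))) (trans (ι-* ℤ.-1ℤ i) (ℚ-neg (ι i)))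
  where
  open +-*-Solver
  ℚ-neg : ∀ x → ℚ.- 1ℚ ℚ.* x ≡ ℚ.- x
  ℚ-neg = solve 1 (λ x → (:- con 1ℚ) :* x := :- x) refl

ι-injective : ∀ {i j} → ι i ≡ ι j → i ≡ j
ι-injective {i} {j} eq = cong ℚ.↥_ (trans (sym (ι≡mkℚ i)) (trans eq (ι≡mkℚ j)))

ι-mono-< : ∀ {i j} → i < j → ι i ℚ.< ι j
ι-mono-< {i} {j} i<j = subst₂ ℚ._<_ (sym (ι≡mkℚ i)) (sym (ι≡mkℚ j))
  (ℚ.*<* (subst₂ _<_ (sym (ℤ.*-identityʳ i)) (sym (ℤ.*-identityʳ j)) i<j))

-- Quotients are used below only through this equation.
fraction : ∀ x y → y ≢ 0ℚ → ∃ λ s → s ℚ.* y ≡ x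
fraction x y y≢0 = x ℚ.* y⁻¹ , trans (ℚ.*-assoc x y⁻¹ y)
  (trans (cong (x ℚ.*_) (ℚ.*-inverseˡ y {{ℚ.≢-nonZero y≢0}})) (ℚ.*-identityʳ x))
  where y⁻¹ = (1/ y) {{ℚ.≢-nonZero y≢0}}

p<q⇒0<q-p : ∀ {p q} → p ℚ.< q → 0ℚ ℚ.< q ℚ.- p
p<q⇒0<q-p {p} {q} p<q = subst (ℚ._< q ℚ.- p) (ℚ.+-inverseʳ p) (ℚ.+-monoˡ-< (ℚ.- p) p<q)

∣∣-< : ∀ {x ε} → x ℚ.< ε → ℚ.- x ℚ.< ε → ℚ.∣ x ∣ ℚ.< ε
∣∣-< {x} x<ε -x<ε with ℚ.∣p∣≡p∨∣p∣≡-p x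
... | inj₁ eq = subst (ℚ._< _) (sym eq) x<ε
... | inj₂ eq = subst (ℚ._< _) (sym eq) -x<ε

-- `mkℚ` stores the denominator minus one, so this is 1/(n+1).
unit-fraction : ℕ → ℚ
unit-fraction n = mkℚ (+ 1) n (Coprimality.1-coprimeTo (suc n))

*-unit-fraction : ∀ n → ι (+ suc n) ℚ.* unit-fraction n ≡ 1ℚ
*-unit-fraction n = trans (cong (ℚ._* unit-fraction n) (ι≡mkℚ (+ suc n)))
  (ℚ.*-inverseʳ (mkℚ (+ suc n) 0 (Coprimality.sym (Coprimality.1-coprimeTo (suc n)))))

unit-fraction-small : ∀ {ε} → 0ℚ ℚ.< ε → ∃ λ N → ∀ n → N ℕ.≤ n → unit-fraction n ℚ.< ε
-- A positive rational with denominator `suc d` is at least 1/(d+1), hence the threshold `suc d`.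
unit-fraction-small {mkℚ +[1+ c ] d _} _ = suc d , λ n d<n → ℚ.*<* (+<+ (begin-strict
  1 ℕ.* suc d       ≡⟨ ℕ.*-identityˡ (suc d) ⟩
  suc d             <⟨ s≤s d<n ⟩
  suc n             ≤⟨ ℕ.m≤n*m (suc n) (suc c) ⟩
  suc c ℕ.* suc n   ∎))
  where open ℕ.≤-Reasoning
unit-fraction-small {mkℚ +0       d _} (ℚ.*<* (+<+ ()))
unit-fraction-small {mkℚ -[1+ c ] d _} (ℚ.*<* ())

-- Dedekind cuts

last-step : ExcludedMiddle ℓ → (P : Pred ℕ ℓ) → 0 ∈ P → ∀ n → n ∉ P →
  ∃ λ j → j ∈ P × suc j ∉ P
last-step em P P0 ℕ.zero  ¬Pn = contradiction P0 ¬Pn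
last-step em P P0 (suc n) ¬Pn with em {P n}
... | yes Pn = n , Pn , ¬Pn
... | no ¬Pn = last-step em P P0 n ¬Pn

module Cut (em : ExcludedMiddle ℓ) {S : Pred ℚ ℓ} (down : ∀ {s t} → s ℚ.≤ t → t ∈ S → s ∈ S)
  {lo hi : ℚ} (lo∈S : lo ∈ S) (hi∉S : hi ∉ S) where

  below-∉ : ∀ {s t} → s ∈ S → t ∉ S → s ℚ.< t
  below-∉ s∈S t∉S = ℚ.≰⇒> λ t≤s → t∉S (down t≤s s∈S)

  0<width : 0ℚ ℚ.< hi ℚ.- lo
  0<width = p<q⇒0<q-p (below-∉ lo∈S hi∉S)

  mesh : ℕ → ℚ
  mesh n = (hi ℚ.- lo) ℚ.* unit-fraction n

  grid : ℕ → ℕ → ℚ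
  grid n j = lo ℚ.+ ι (+ j) ℚ.* mesh n

  grid-0 : ∀ n → grid n 0 ≡ lo
  grid-0 n = trans (cong (lo ℚ.+_) (ℚ.*-zeroˡ (mesh n))) (ℚ.+-identityʳ lo)

  grid-end : ∀ n → grid n (suc n) ≡ hi
  grid-end n = begin
    lo ℚ.+ ι (+ suc n) ℚ.* ((hi ℚ.- lo) ℚ.* unit-fraction n)
      ≡⟨ regroup lo hi (ι (+ suc n)) (unit-fraction n) ⟩
    lo ℚ.+ (ι (+ suc n) ℚ.* unit-fraction n) ℚ.* (hi ℚ.- lo)
      ≡⟨ cong (λ u → lo ℚ.+ u ℚ.* (hi ℚ.- lo)) (*-unit-fraction n) ⟩
    lo ℚ.+ 1ℚ ℚ.* (hi ℚ.- lo)
      ≡⟨ collapse lo hi ⟩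
    hi ∎
    where
    open ≡-Reasoning
    open +-*-Solver
    regroup : ∀ l h k u → l ℚ.+ k ℚ.* ((h ℚ.- l) ℚ.* u) ≡ l ℚ.+ (k ℚ.* u) ℚ.* (h ℚ.- l)
    regroup = solve 4 (λ l h k u → l :+ k :* ((h :- l) :* u) := l :+ (k :* u) :* (h :- l)) refl
    collapse : ∀ l h → l ℚ.+ 1ℚ ℚ.* (h ℚ.- l) ≡ h
    collapse = solve 2 (λ l h → l :+ con 1ℚ :* (h :- l) := h) refl

  grid-suc : ∀ n j → grid n (suc j) ≡ grid n j ℚ.+ mesh n
  grid-suc n j = trans (cong (λ k → lo ℚ.+ k ℚ.* mesh n) (ι-+ (+ 1) (+ j)))
    (regroup lo (ι (+ j)) (mesh n))
    where
    open +-*-Solver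
    regroup : ∀ l k m → l ℚ.+ (1ℚ ℚ.+ k) ℚ.* m ≡ l ℚ.+ k ℚ.* m ℚ.+ m
    regroup = solve 3 (λ l k m → l :+ (con 1ℚ :+ k) :* m := l :+ k :* m :+ m) refl

  crossing : ∀ n → ∃ λ j → grid n j ∈ S × grid n (suc j) ∉ S
  crossing n = last-step em (λ j → grid n j ∈ S)
    (subst S (sym (grid-0 n)) lo∈S) (suc n) (λ end∈S → hi∉S (subst S (grid-end n) end∈S))

  -- The interval from `lo` to `hi` is cut into `suc n` cells, and this is the left end of a cell
  -- where `S` is left. It bounds the supremum from below with error at most `mesh n`.
  approx : ℕ → ℚ
  approx n = grid n (proj₁ (crossing n))

  approx∈S : ∀ n → approx n ∈ S
  approx∈S n = proj₁ (proj₂ (crossing n))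

  approx+mesh∉S : ∀ n → approx n ℚ.+ mesh n ∉ S
  approx+mesh∉S n s∈S = proj₂ (proj₂ (crossing n))
    (subst S (sym (grid-suc n (proj₁ (crossing n)))) s∈S)

  mesh-small : ∀ {ε} → 0ℚ ℚ.< ε → ∃ λ N → ∀ n → N ℕ.≤ n → mesh n ℚ.< ε
  mesh-small {ε} 0<ε =
    let η , ηw≡ε = fraction ε w w≢0
        N , small = unit-fraction-small {η} (ℚ.*-cancelʳ-<-nonNeg w {{ℚ.pos⇒nonNeg w}}
          (subst₂ ℚ._<_ (sym (ℚ.*-zeroˡ w)) (sym ηw≡ε) 0<ε))
    in N , λ n N≤n → subst₂ ℚ._<_ (ℚ.*-comm (unit-fraction n) w) ηw≡ε
         (ℚ.*-monoˡ-<-pos w (small n N≤n))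
    where
    w = hi ℚ.- lo
    w≢0 : w ≢ 0ℚ
    w≢0 w≡0 = ℚ.<-irrefl (sym w≡0) 0<width
    instance
      w>0 : ℚ.Positive w
      w>0 = ℚ.positive 0<width

  -- Every member of `S` lies below the nonmember `approx n + mesh n`.
  ∈S⇒<approx+ : ∀ {s ε} → s ∈ S → 0ℚ ℚ.< ε → ∃ λ N → ∀ n → N ℕ.≤ n → s ℚ.< approx n ℚ.+ ε
  ∈S⇒<approx+ s∈S 0<ε =
    let N , small = mesh-small 0<ε
    in N , λ n N≤n → ℚ.<-trans (below-∉ s∈S (approx+mesh∉S n)) (ℚ.+-monoʳ-< (approx n) (small n N≤n))

  approx-cauchy : Cauchy approx
  approx-cauchy ε 0<ε =
    let N , small = mesh-small 0<ε
        -- Only `n` has to be large: `approx m` is in `S`, so it lies below `approx n + mesh n`.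
        -- Exchanging `m` and `n` gives the other sign.
        close : ∀ m n → N ℕ.≤ n → approx m ℚ.- approx n ℚ.< ε
        close m n N≤n = subst (approx m ℚ.- approx n ℚ.<_) (cancel (approx n) ε)
          (ℚ.+-monoˡ-< (ℚ.- approx n) (ℚ.<-trans (below-∉ (approx∈S m) (approx+mesh∉S n))
            (ℚ.+-monoʳ-< (approx n) (small n N≤n))))
    in N , λ m n N≤m N≤n → ∣∣-< (close m n N≤n)
         (subst (ℚ._< ε) (swap (approx m) (approx n)) (close n m N≤m))
    where
    open +-*-Solver
    cancel : ∀ x e → x ℚ.+ e ℚ.- x ≡ e
    cancel = solve 2 (λ x e → x :+ e :- x := e) refl
    swap : ∀ x y → y ℚ.- x ≡ ℚ.- (x ℚ.- y)
    swap = solve 2 (λ x y → y :- x := :- (x :- y)) refl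

  supremum : ℝ
  supremum = mkℝ approx approx-cauchy

-- Half-planes

-- If both coordinates of `v` tend to zero, so does the scalar product with the fixed point `A`,
-- which contradicts the gap `ε`.
halfPlane⇒¬origin : ∀ {v A} → embed A ∈ HalfPlane v → ¬ IsOrigin v
halfPlane⇒¬origin {v₁ , v₂} {x , y} (ε , 0<ε , N , ε≤) (v₁≈0 , v₂≈0) =
  let N₁ , small₁ = v₁≈0 η 0<η
      N₂ , small₂ = v₂≈0 η 0<η
      n = N ℕ.⊔ (N₁ ℕ.⊔ N₂)
      N₁⊔N₂≤n = ℕ.m≤n⊔m N (N₁ ℕ.⊔ N₂)
  in ℚ.<-irrefl refl (estimate (seq v₁ n) (seq v₂ n)
       (ε≤ n (ℕ.m≤m⊔n N (N₁ ℕ.⊔ N₂)))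
       (small₁ n (ℕ.≤-trans (ℕ.m≤m⊔n N₁ N₂) N₁⊔N₂≤n))
       (small₂ n (ℕ.≤-trans (ℕ.m≤n⊔m N₁ N₂) N₁⊔N₂≤n)))
  where
  open ℚ.≤-Reasoning
  open +-*-Solver
  p = ℚ.∣ ι x ∣
  q = ℚ.∣ ι y ∣
  -- The summand `1ℚ` makes `K` positive, so that `ε` can be divided by it, and makes the final
  -- estimate strict.
  K = 1ℚ ℚ.+ (p ℚ.+ q)
  0<K : 0ℚ ℚ.< K
  0<K = ℚ.+-mono-<-≤ (ℚ.positive⁻¹ 1ℚ) (ℚ.+-mono-≤ (ℚ.0≤∣p∣ (ι x)) (ℚ.0≤∣p∣ (ι y)))
  K≢0 : K ≢ 0ℚ
  K≢0 K≡0 = ℚ.<-irrefl (sym K≡0) 0<K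
  η = proj₁ (fraction ε K K≢0)
  ηK≡ε : η ℚ.* K ≡ ε
  ηK≡ε = proj₂ (fraction ε K K≢0)
  0<η : 0ℚ ℚ.< η
  0<η = ℚ.*-cancelʳ-<-nonNeg K {{ℚ.pos⇒nonNeg K {{ℚ.positive 0<K}}}}
    (subst₂ ℚ._<_ (sym (ℚ.*-zeroˡ K)) (sym ηK≡ε) 0<ε)
  regroup : ∀ η p q → η ℚ.+ (η ℚ.* p ℚ.+ η ℚ.* q) ≡ η ℚ.* (1ℚ ℚ.+ (p ℚ.+ q))
  regroup = solve 3 (λ η p q → η :+ (η :* p :+ η :* q) := η :* (con 1ℚ :+ (p :+ q))) refl
  i≤∣i∣ : ∀ i → i ℚ.≤ ℚ.∣ i ∣
  i≤∣i∣ i with ℚ.≤-total 0ℚ i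
  ... | inj₁ 0≤i = ℚ.≤-reflexive (sym (ℚ.0≤p⇒∣p∣≡p 0≤i))
  ... | inj₂ i≤0 = ℚ.≤-trans i≤0 (ℚ.0≤∣p∣ i)
  term : ∀ c z → ℚ.∣ c ℚ.- 0ℚ ∣ ℚ.< η → c ℚ.* z ℚ.≤ η ℚ.* ℚ.∣ z ∣
  term c z c<η = begin
    c ℚ.* z               ≤⟨ i≤∣i∣ (c ℚ.* z) ⟩
    ℚ.∣ c ℚ.* z ∣         ≡⟨ ℚ.∣p*q∣≡∣p∣*∣q∣ c z ⟩
    ℚ.∣ c ∣ ℚ.* ℚ.∣ z ∣   ≤⟨ ℚ.*-monoʳ-≤-nonNeg ℚ.∣ z ∣ {{ℚ.nonNegative (ℚ.0≤∣p∣ z)}}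
                               (ℚ.<⇒≤ (subst (λ d → ℚ.∣ d ∣ ℚ.< η) (ℚ.+-identityʳ c) c<η)) ⟩
    η ℚ.* ℚ.∣ z ∣         ∎
  estimate : ∀ c d → 0ℚ ℚ.+ ε ℚ.≤ c ℚ.* ι x ℚ.+ d ℚ.* ι y →
    ℚ.∣ c ℚ.- 0ℚ ∣ ℚ.< η → ℚ.∣ d ℚ.- 0ℚ ∣ ℚ.< η → ε ℚ.< ε
  estimate c d ε≤ c<η d<η = begin-strict
    ε                               ≡⟨ ℚ.+-identityˡ ε ⟨
    0ℚ ℚ.+ ε                        ≤⟨ ε≤ ⟩
    c ℚ.* ι x ℚ.+ d ℚ.* ι y         ≤⟨ ℚ.+-mono-≤ (term c (ι x) c<η) (term d (ι y) d<η) ⟩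
    η ℚ.* p ℚ.+ η ℚ.* q             ≡⟨ ℚ.+-identityˡ _ ⟨
    0ℚ ℚ.+ (η ℚ.* p ℚ.+ η ℚ.* q)    <⟨ ℚ.+-monoˡ-< (η ℚ.* p ℚ.+ η ℚ.* q) 0<η ⟩
    η ℚ.+ (η ℚ.* p ℚ.+ η ℚ.* q)     ≡⟨ regroup η p q ⟩
    η ℚ.* K                         ≡⟨ ηK≡ε ⟩
    ε                               ∎

-- No point of X lies on a supporting line

det-swap : ∀ x y → det y x ≡ - det x y
det-swap (x₁ , x₂) (y₁ , y₂) = expand x₁ x₂ y₁ y₂
  where
  expand : ∀ a b c d → c * b - d * a ≡ - (a * d - b * c)
  expand = solve-∀

-- The map sending `x` to `(dot a x , det a x)` has determinant `dot a a`; the right side is the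
-- determinant of the images of `x` and `y`.
det-dot : ∀ a x y → dot a a * det x y ≡ dot a x * det a y - det a x * dot a y
det-dot (a , b) (x , y) (u , v) = expand a b x y u v
  where
  expand : ∀ a b x y u v → (a * a + b * b) * (x * v - y * u)
    ≡ (a * x + b * y) * (a * v - b * u) - (a * y - b * x) * (a * u + b * v)
  expand = solve-∀

-- The linear dependence of three plane vectors, ordered so that `no-zero-sum` applies when
-- `det a x` is positive.
det-relation : ∀ a x y → det a x · y ⊕ (det x y · a ⊕ (- det a y) · x) ≡ O
det-relation (a , b) (x , y) (u , v) = cong₂ _,_ (expand₁ a b x y u v) (expand₂ a b x y u v)
  where
  expand₁ : ∀ a b x y u v →
    (a * y - b * x) * u + ((x * v - y * u) * a + - (a * v - b * u) * x) ≡ 0ℤ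
  expand₁ = solve-∀
  expand₂ : ∀ a b x y u v →
    (a * y - b * x) * v + ((x * v - y * u) * b + - (a * v - b * u) * y) ≡ 0ℤ
  expand₂ = solve-∀

-- For `x` on the line of `a`, projection onto `a` loses nothing. The term `0ℤ · a` pads the
-- relation to the shape of `no-zero-sum`.
collinear-relation : ∀ a x → det a x ≡ 0ℤ → dot a a · x ⊕ ((- dot a x) · a ⊕ 0ℤ · a) ≡ O
collinear-relation (a , b) (x , y) det≡0 = cong₂ _,_
  (trans (expand₁ a b x y) (trans (cong (_* - b) det≡0) (ℤ.*-zeroˡ (- b))))
  (trans (expand₂ a b x y) (trans (cong (_* a) det≡0) (ℤ.*-zeroˡ a)))
  where
  expand₁ : ∀ a b x y → (a * a + b * b) * x + (- (a * x + b * y) * a + 0ℤ * a) ≡ (a * y - b * x) * - b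
  expand₁ = solve-∀
  expand₂ : ∀ a b x y → (a * a + b * b) * y + (- (a * x + b * y) * b + 0ℤ * b) ≡ (a * y - b * x) * a
  expand₂ = solve-∀

0<i-j⇒j<i : ∀ {i j} → 0ℤ < i - j → j < i
0<i-j⇒j<i {i} {j} 0<i-j = subst₂ _<_ (ℤ.+-identityˡ j) (cancel i j) (ℤ.+-monoˡ-< j 0<i-j)
  where
  cancel : ∀ i j → i - j + j ≡ i
  cancel = solve-∀

i-j<0⇒i<j : ∀ {i j} → i - j < 0ℤ → i < j
i-j<0⇒i<j {i} {j} i-j<0 = subst₂ _<_ (cancel i j) (ℤ.+-identityˡ j) (ℤ.+-monoˡ-< j i-j<0)
  where
  cancel : ∀ i j → i - j + j ≡ i
  cancel = solve-∀

module Unsupported (em : ExcludedMiddle ℓ) {X : Pred ℤ² ℓ} (bpp : BPP X)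
  {a : ℤ²} (a∈X : a ∈ X) (a≢O : a ≢ O)
  (left  : ∀ {x} → x ∈ X → ∃ λ y → y ∈ X × 0ℤ < det x y)
  (right : ∀ {x} → x ∈ X → ∃ λ y → y ∈ X × det x y < 0ℤ) where

  p q : ℤ² → ℤ
  p = dot a
  q = det a

  instance
    N>0 : ℤ.Positive (dot a a)
    N>0 = ℤ.positive (0<dot-self a a≢O)

    N≥0 : ℤ.NonNegative (dot a a)
    N≥0 = ℤ.nonNegative (ℤ.<⇒≤ (0<dot-self a a≢O))

  -- Otherwise all coefficients in `det-relation` are nonnegative and `q x` is positive, a forbidden
  -- zero sum. In terms of slopes p/q: that of `y` is smaller than that of `x`.
  opposite : ∀ {x y} → x ∈ X → y ∈ X → 0ℤ < q x → q y < 0ℤ → det x y < 0ℤ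
  opposite {x} {y} x∈X y∈X 0<qx qy<0 = ℤ.≰⇒> λ 0≤det →
    no-zero-sum bpp y∈X a∈X x∈X 0<qx 0≤det (ℤ.neg-mono-≤ (ℤ.<⇒≤ qy<0)) (det-relation a x y)

  collinear : ∀ {x} → x ∈ X → q x ≡ 0ℤ → 0ℤ < p x
  collinear {x} x∈X qx≡0 = ℤ.≰⇒> λ px≤0 →
    no-zero-sum bpp x∈X a∈X a∈X (0<dot-self a a≢O) (ℤ.neg-mono-≤ px≤0) ℤ.≤-refl
      (collinear-relation a x qx≡0)

  0<det⇒cross : ∀ x y → 0ℤ < det x y → q x * p y < p x * q y
  0<det⇒cross x y 0<det = 0<i-j⇒j<i (subst₂ _<_ (ℤ.*-zeroʳ (dot a a)) (det-dot a x y)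
    (ℤ.*-monoˡ-<-pos (dot a a) 0<det))

  det<0⇒cross : ∀ x y → det x y < 0ℤ → p x * q y < q x * p y
  det<0⇒cross x y det<0 = i-j<0⇒i<j (subst₂ _<_ (det-dot a x y) (ℤ.*-zeroʳ (dot a a))
    (ℤ.*-monoˡ-<-pos (dot a a) det<0))

  -- With `left` this shows that the slopes of the points with `q` positive have no least element:
  -- `y` has smaller slope than `x`.
  left-of-left : ∀ {x y} → x ∈ X → y ∈ X → 0ℤ < q x → 0ℤ < det x y → 0ℤ < q y
  left-of-left {x} {y} x∈X y∈X 0<qx 0<det with ℤ.<-cmp (q y) 0ℤ
  ... | tri> _ _ 0<qy = 0<qy
  ... | tri< qy<0 _ _ = contradiction (opposite x∈X y∈X 0<qx qy<0) (ℤ.<-asym 0<det)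
  ... | tri≈ _ qy≡0 _ = contradiction
    (subst (q x * p y <_) (trans (cong (p x *_) qy≡0) (ℤ.*-zeroʳ (p x))) (0<det⇒cross x y 0<det))
    (ℤ.<-asym (subst (_< q x * p y) (ℤ.*-zeroʳ (q x))
      (ℤ.*-monoˡ-<-pos (q x) {{ℤ.positive 0<qx}} (collinear y∈X qy≡0))))

  -- The mirror image: the slopes of the points with `q` negative have no greatest element.
  right-of-right : ∀ {x y} → x ∈ X → y ∈ X → q x < 0ℤ → det x y < 0ℤ → q y < 0ℤ
  right-of-right {x} {y} x∈X y∈X qx<0 det<0 with ℤ.<-cmp (q y) 0ℤ
  ... | tri< qy<0 _ _ = qy<0
  ... | tri> _ _ 0<qy = contradiction
    (subst (_< 0ℤ) (det-swap x y) (opposite y∈X x∈X 0<qy qx<0))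
    (ℤ.<-asym (ℤ.neg-mono-< det<0))
  ... | tri≈ _ qy≡0 _ = contradiction
    (subst (_< q x * p y) (trans (cong (p x *_) qy≡0) (ℤ.*-zeroʳ (p x))) (det<0⇒cross x y det<0))
    (ℤ.<-asym (subst (q x * p y <_) (ℤ.*-zeroʳ (q x))
      (ℤ.*-monoˡ-<-neg (q x) {{ℤ.negative qx<0}} (collinear y∈X qy≡0))))

  slope : ∀ x → q x ≢ 0ℤ → ∃ λ s → s ℚ.* ι (q x) ≡ ι (p x)
  slope x qx≢0 = fraction (ι (p x)) (ι (q x)) (λ ιq≡0 → qx≢0 (ι-injective ιq≡0))

  regroup : ∀ c s d → c ℚ.* (s ℚ.* d) ≡ s ℚ.* c ℚ.* d
  regroup = solve 3 (λ c s d → c :* (s :* d) := s :* c :* d) refl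
    where open +-*-Solver

  -- Multiplying the claim by `q y` gives `cross`. The sign of `q x` is left open, so no division by
  -- it occurs.
  slope-<₊ : ∀ s x y → 0ℤ < q y → s ℚ.* ι (q y) ≡ ι (p y) → q x * p y < p x * q y →
    s ℚ.* ι (q x) ℚ.< ι (p x)
  slope-<₊ s x y 0<qy s≡ cross = ℚ.*-cancelʳ-<-nonNeg (ι (q y))
    {{ℚ.nonNegative (ℚ.<⇒≤ (ι-mono-< 0<qy))}}
    (subst₂ ℚ._<_ (trans (ι-* (q x) (p y)) (trans (cong (ι (q x) ℚ.*_) (sym s≡))
        (regroup (ι (q x)) s (ι (q y)))))
      (ι-* (p x) (q y)) (ι-mono-< cross))

  slope-<₋ : ∀ s x y → q y < 0ℤ → s ℚ.* ι (q y) ≡ ι (p y) → p x * q y < q x * p y →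
    s ℚ.* ι (q x) ℚ.< ι (p x)
  slope-<₋ s x y qy<0 s≡ cross = ℚ.*-cancelʳ-<-nonPos (ι (q y))
    {{ℚ.nonPositive (ℚ.<⇒≤ (ι-mono-< qy<0))}}
    (subst₂ ℚ._<_ (ι-* (p x) (q y))
      (trans (ι-* (q x) (p y)) (trans (cong (ι (q x) ℚ.*_) (sym s≡))
        (regroup (ι (q x)) s (ι (q y)))))
      (ι-mono-< cross))

  -- The rational lower bounds of the slopes of the points with `q` positive; the supremum of `S` is
  -- the infimum of these slopes.
  S : Pred ℚ ℓ
  S s = ∀ {x} → x ∈ X → 0ℤ < q x → s ℚ.* ι (q x) ℚ.≤ ι (p x)

  S-down : ∀ {s t} → s ℚ.≤ t → t ∈ S → s ∈ S
  S-down {s} {t} s≤t t∈S {x} x∈X 0<qx = ℚ.≤-trans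
    (ℚ.*-monoʳ-≤-nonNeg (ι (q x)) {{ℚ.nonNegative (ℚ.<⇒≤ (ι-mono-< 0<qx))}} s≤t) (t∈S x∈X 0<qx)

  right-slope∈S : ∀ s {y} → y ∈ X → q y < 0ℤ → s ℚ.* ι (q y) ≡ ι (p y) → s ∈ S
  right-slope∈S s {y} y∈X qy<0 s≡ {x} x∈X 0<qx =
    ℚ.<⇒≤ (slope-<₋ s x y qy<0 s≡ (det<0⇒cross x y (opposite x∈X y∈X 0<qx qy<0)))

  x₀ y₀ : ℤ²
  x₀ = proj₁ (left a∈X)
  y₀ = proj₁ (right a∈X)

  slope-x₀ : ∃ λ s → s ℚ.* ι (q x₀) ≡ ι (p x₀)
  slope-x₀ = slope x₀ (λ q≡0 → ℤ.<-irrefl (sym q≡0) (proj₂ (proj₂ (left a∈X))))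

  slope-y₀ : ∃ λ s → s ℚ.* ι (q y₀) ≡ ι (p y₀)
  slope-y₀ = slope y₀ (λ q≡0 → ℤ.<-irrefl q≡0 (proj₂ (proj₂ (right a∈X))))

  lo hi : ℚ
  lo = proj₁ slope-y₀
  -- `S` is defined by a weak inequality, so the slope of `x₀` is raised by 1 to violate it.
  hi = proj₁ slope-x₀ ℚ.+ 1ℚ

  lo∈S : lo ∈ S
  lo∈S = right-slope∈S lo (proj₁ (proj₂ (right a∈X))) (proj₂ (proj₂ (right a∈X))) (proj₂ slope-y₀)

  hi∉S : hi ∉ S
  hi∉S hi∈S = ℚ.<-irrefl refl (ℚ.<-≤-trans p₀<hi*q₀ (hi∈S x₀∈X 0<q₀))
    where
    x₀∈X = proj₁ (proj₂ (left a∈X))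
    0<q₀ = proj₂ (proj₂ (left a∈X))
    s₀ = proj₁ slope-x₀
    p₀<hi*q₀ : ι (p x₀) ℚ.< hi ℚ.* ι (q x₀)
    p₀<hi*q₀ = subst₂ ℚ._<_ (proj₂ slope-x₀) refl
      (ℚ.*-monoˡ-<-pos (ι (q x₀)) {{ℚ.positive (ι-mono-< 0<q₀)}}
        (subst (ℚ._< hi) (ℚ.+-identityʳ s₀) (ℚ.+-monoʳ-< s₀ (ℚ.positive⁻¹ 1ℚ))))

  open Cut em {S} (λ {s} {t} → S-down {s} {t}) {lo} {hi} lo∈S hi∉S

  r : ℝ
  r = supremum

  -- `a` minus `r` times its quarter turn, so that the scalar product with `x` is `p x - r q x`.
  normal : ℝ²
  normal = fromℤ (proj₁ a) ℝ.+ r ℝ.* fromℤ (proj₂ a)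
         , fromℤ (proj₂ a) ℝ.+ r ℝ.* fromℤ (- proj₁ a)

  normal-dot : ∀ x n →
    seq (proj₁ normal ℝ.* fromℤ (proj₁ x) ℝ.+ proj₂ normal ℝ.* fromℤ (proj₂ x)) n
      ≡ ι (p x) ℚ.- approx n ℚ.* ι (q x)
  normal-dot (x , y) n = begin
    (ι b₁ ℚ.+ s ℚ.* ι b₂) ℚ.* ι x ℚ.+ (ι b₂ ℚ.+ s ℚ.* ι (- b₁)) ℚ.* ι y
      ≡⟨ cong (λ c → (ι b₁ ℚ.+ s ℚ.* ι b₂) ℚ.* ι x ℚ.+ (ι b₂ ℚ.+ s ℚ.* c) ℚ.* ι y) (ι-neg b₁) ⟩
    (ι b₁ ℚ.+ s ℚ.* ι b₂) ℚ.* ι x ℚ.+ (ι b₂ ℚ.+ s ℚ.* ℚ.- ι b₁) ℚ.* ι y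
      ≡⟨ expand (ι b₁) (ι b₂) s (ι x) (ι y) ⟩
    (ι b₁ ℚ.* ι x ℚ.+ ι b₂ ℚ.* ι y) ℚ.- s ℚ.* (ι b₁ ℚ.* ι y ℚ.- ι b₂ ℚ.* ι x)
      ≡⟨ cong₂ (λ c d → c ℚ.- s ℚ.* d) ιp ιq ⟨
    ι (p (x , y)) ℚ.- s ℚ.* ι (q (x , y)) ∎
    where
    open ≡-Reasoning
    open +-*-Solver
    b₁ = proj₁ a
    b₂ = proj₂ a
    s = approx n
    ιp : ι (b₁ * x + b₂ * y) ≡ ι b₁ ℚ.* ι x ℚ.+ ι b₂ ℚ.* ι y
    ιp = trans (ι-+ (b₁ * x) (b₂ * y)) (cong₂ ℚ._+_ (ι-* b₁ x) (ι-* b₂ y))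
    ιq : ι (b₁ * y - b₂ * x) ≡ ι b₁ ℚ.* ι y ℚ.- ι b₂ ℚ.* ι x
    ιq = trans (ι-+ (b₁ * y) (- (b₂ * x))) (cong₂ ℚ._+_ (ι-* b₁ y)
      (trans (ι-neg (b₂ * x)) (cong ℚ.-_ (ι-* b₂ x))))
    expand : ∀ a b s x y →
      (a ℚ.+ s ℚ.* b) ℚ.* x ℚ.+ (b ℚ.+ s ℚ.* ℚ.- a) ℚ.* y
        ≡ (a ℚ.* x ℚ.+ b ℚ.* y) ℚ.- s ℚ.* (a ℚ.* y ℚ.- b ℚ.* x)
    expand = solve 5 (λ a b s x y →
      (a :+ s :* b) :* x :+ (b :+ s :* (:- a)) :* y
        := (a :* x :+ b :* y) :- s :* (a :* y :- b :* x)) refl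

  -- `HalfPlane` needs a gap independent of `n`. A rational `s` between the approximations and the
  -- slope of `x` supplies it as `p x - s q x`.
  inside : ∀ s x → s ℚ.* ι (q x) ℚ.< ι (p x) →
    (∃ λ N → ∀ n → N ℕ.≤ n → approx n ℚ.* ι (q x) ℚ.≤ s ℚ.* ι (q x)) →
    embed x ∈ HalfPlane normal
  inside s x sq<p (N , below) = ι (p x) ℚ.- s ℚ.* ι (q x) , p<q⇒0<q-p sq<p , N , λ n N≤n → begin
    0ℚ ℚ.+ (ι (p x) ℚ.- s ℚ.* ι (q x))    ≡⟨ ℚ.+-identityˡ _ ⟩
    ι (p x) ℚ.- s ℚ.* ι (q x)             ≤⟨ ℚ.+-monoʳ-≤ (ι (p x)) (ℚ.neg-antimono-≤ (below n N≤n)) ⟩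
    ι (p x) ℚ.- approx n ℚ.* ι (q x)      ≡⟨ normal-dot x n ⟨
    seq (proj₁ normal ℝ.* fromℤ (proj₁ x) ℝ.+ proj₂ normal ℝ.* fromℤ (proj₂ x)) n ∎
    where open ℚ.≤-Reasoning

  inside-axis : ∀ {x} → x ∈ X → q x ≡ 0ℤ → embed x ∈ HalfPlane normal
  inside-axis {x} x∈X qx≡0 = inside 0ℚ x
    (subst (ℚ._< ι (p x)) (sym (vanish 0ℚ)) (ι-mono-< (collinear x∈X qx≡0)))
    (0 , λ n _ → ℚ.≤-reflexive (trans (vanish (approx n)) (sym (vanish 0ℚ))))
    where
    vanish : ∀ s → s ℚ.* ι (q x) ≡ 0ℚ
    vanish s = trans (cong (λ i → s ℚ.* ι i) qx≡0) (ℚ.*-zeroʳ s)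

  -- The slope `s` of a point `y` to the left of `x` separates: it is smaller than that of `x`, and
  -- no member of `S` exceeds it.
  inside-left : ∀ {x} → x ∈ X → 0ℤ < q x → embed x ∈ HalfPlane normal
  inside-left {x} x∈X 0<qx =
    let y , y∈X , 0<det = left x∈X
        0<qy = left-of-left x∈X y∈X 0<qx 0<det
        s , s≡ = slope y (λ q≡0 → ℤ.<-irrefl (sym q≡0) 0<qy)
    in inside s x (slope-<₊ s x y 0<qy s≡ (0<det⇒cross x y 0<det))
         (0 , λ n _ → ℚ.*-monoʳ-≤-nonNeg (ι (q x)) {{ℚ.nonNegative (ℚ.<⇒≤ (ι-mono-< 0<qx))}}
           (ℚ.*-cancelʳ-≤-pos {approx n} {s} (ι (q y)) {{ℚ.positive (ι-mono-< 0<qy)}}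
             (subst (approx n ℚ.* ι (q y) ℚ.≤_) (sym s≡) (approx∈S n y∈X 0<qy))))

  -- Two steps to the right are needed. The approximations come from below, so they eventually pass
  -- the slope `s` of `y` only because a larger slope `t`, that of `z`, is still in `S`.
  inside-right : ∀ {x} → x ∈ X → q x < 0ℤ → embed x ∈ HalfPlane normal
  inside-right {x} x∈X qx<0 =
    let y , y∈X , xy<0 = right x∈X
        qy<0 = right-of-right x∈X y∈X qx<0 xy<0
        z , z∈X , yz<0 = right y∈X
        qz<0 = right-of-right y∈X z∈X qy<0 yz<0
        s , s≡ = slope y (λ q≡0 → ℤ.<-irrefl q≡0 qy<0)
        t , t≡ = slope z (λ q≡0 → ℤ.<-irrefl q≡0 qz<0)
        s<t : s ℚ.< t
        s<t = ℚ.*-cancelʳ-<-nonPos {t} {s} (ι (q y)) {{ℚ.nonPositive (ℚ.<⇒≤ (ι-mono-< qy<0))}}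
          (subst (t ℚ.* ι (q y) ℚ.<_) (sym s≡) (slope-<₋ t y z qz<0 t≡ (det<0⇒cross y z yz<0)))
        -- With margin `t - s`, the bound `t < approx n + (t - s)` says `s < approx n`.
        N , eventually = ∈S⇒<approx+ {t} (right-slope∈S t z∈X qz<0 t≡) (p<q⇒0<q-p s<t)
    in inside s x (slope-<₋ s x y qy<0 s≡ (det<0⇒cross x y xy<0))
         (N , λ n N≤n → ℚ.*-monoʳ-≤-nonPos (ι (q x)) {{ℚ.nonPositive (ℚ.<⇒≤ (ι-mono-< qx<0))}}
           (ℚ.<⇒≤ (shift s t (approx n) (eventually n N≤n))))
    where
    open +-*-Solver
    shift : ∀ s t u → t ℚ.< u ℚ.+ (t ℚ.- s) → s ℚ.< u
    shift s t u t< = subst₂ ℚ._<_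
      (solve 2 (λ s t → t :+ (s :- t) := s) refl s t)
      (solve 3 (λ s t u → u :+ (t :- s) :+ (s :- t) := u) refl s t u)
      (ℚ.+-monoˡ-< (s ℚ.- t) t<)

  X⊆HalfPlane : ∀ {x} → x ∈ X → embed x ∈ HalfPlane normal
  X⊆HalfPlane {x} x∈X = by-sign (ℤ.<-cmp (q x) 0ℤ)
    where
    by-sign : Tri (q x < 0ℤ) (q x ≡ 0ℤ) (0ℤ < q x) → embed x ∈ HalfPlane normal
    by-sign (tri< qx<0 _ _) = inside-right x∈X qx<0
    by-sign (tri≈ _ qx≡0 _) = inside-axis x∈X qx≡0
    by-sign (tri> _ _ 0<qx) = inside-left x∈X 0<qx

  lc : LC X
  lc = normal , halfPlane⇒¬origin {normal} {a} (X⊆HalfPlane a∈X) , X⊆HalfPlane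

-- Case distinction on supporting lines

empty⇒LC : {X : Pred ℤ² ℓ} → (∀ {x} → x ∉ X) → LC X
empty⇒LC X-empty = (fromℤ (+ 1) , 0ℝ) , (λ (1≈0 , _) → 1≉0 1≈0) , λ x∈X → contradiction x∈X X-empty
  where
  1≉0 : ¬ (fromℤ (+ 1) ≈ 0ℝ)
  1≉0 1≈0 = let N , close = 1≈0 1ℚ (ℚ.positive⁻¹ 1ℚ) in ℚ.<-irrefl refl (close N ℕ.≤-refl)

OneSided : Pred ℤ² ℓ → ℤ² → Set ℓ
OneSided X a = (∀ {x} → x ∈ X → 0ℤ ≤ det a x) ⊎ (∀ {x} → x ∈ X → det a x ≤ 0ℤ)

-- The vector `b` is `a` turned by a right angle, in the direction that makes `dot b` nonnegative on
-- `X`; then `det a b` is `dot a a` up to sign.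
oneSided⇒FPP : ExcludedMiddle ℓ → {X : Pred ℤ² ℓ} → BPP X → {a : ℤ²} → a ∈ X → a ≢ O →
  OneSided X a → FPP X
oneSided⇒FPP em bpp {a₁ , a₂} a∈X a≢O (inj₁ 0≤det) =
  SupportingLine.fpp em bpp {a₁ , a₂} { - a₂ , a₁ } a∈X (orthogonal a₁ a₂)
    (λ det≡0 → ℤ.<-irrefl (trans (sym det≡0) (det≡ a₁ a₂)) (0<dot-self (a₁ , a₂) a≢O))
    (λ {x} x∈X → subst (0ℤ ≤_) (dot≡ a₁ a₂ (proj₁ x) (proj₂ x)) (0≤det x∈X))
  where
  orthogonal : ∀ a b → - b * a + a * b ≡ 0ℤ
  orthogonal = solve-∀
  det≡ : ∀ a b → a * a - b * - b ≡ a * a + b * b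
  det≡ = solve-∀
  dot≡ : ∀ a b x y → a * y - b * x ≡ - b * x + a * y
  dot≡ = solve-∀
oneSided⇒FPP em bpp {a₁ , a₂} a∈X a≢O (inj₂ det≤0) =
  SupportingLine.fpp em bpp {a₁ , a₂} {a₂ , - a₁} a∈X (orthogonal a₁ a₂)
    (λ det≡0 → ℤ.<-irrefl (trans (cong -_ (sym det≡0)) (det≡ a₁ a₂)) (0<dot-self (a₁ , a₂) a≢O))
    (λ {x} x∈X → subst (0ℤ ≤_) (dot≡ a₁ a₂ (proj₁ x) (proj₂ x)) (ℤ.neg-mono-≤ (det≤0 x∈X)))
  where
  orthogonal : ∀ a b → b * a + - a * b ≡ 0ℤ
  orthogonal = solve-∀
  det≡ : ∀ a b → - (a * - a - b * b) ≡ a * a + b * b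
  det≡ = solve-∀
  dot≡ : ∀ a b x y → - (a * y - b * x) ≡ b * x + - a * y
  dot≡ = solve-∀

¬oneSided⇒both-sides : ExcludedMiddle ℓ → {X : Pred ℤ² ℓ} → ∀ a → ¬ OneSided X a →
  (∃ λ y → y ∈ X × 0ℤ < det a y) × (∃ λ y → y ∈ X × det a y < 0ℤ)
¬oneSided⇒both-sides em a ¬one =
    decidable-stable em (λ ∄y → ¬one (inj₂ λ x∈X → ℤ.≮⇒≥ λ 0<det → ∄y (_ , x∈X , 0<det)))
  , decidable-stable em (λ ∄y → ¬one (inj₁ λ x∈X → ℤ.≮⇒≥ λ det<0 → ∄y (_ , x∈X , det<0)))

proposition2p43 : ∀ {ℓ} → ExcludedMiddle ℓ → (X : Pred ℤ² ℓ) → IsStepSet X → ¬ LC X → BPP X → FPP X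
proposition2p43 em X O∉X ¬lc bpp with em {∃ λ a → a ∈ X × OneSided X a} | em {∃ λ a → a ∈ X}
... | yes (a , a∈X , one) | _ = oneSided⇒FPP em bpp {a} a∈X (λ { refl → O∉X a∈X }) one
-- In the two remaining cases LC holds: vacuously for empty `X`, and by `Unsupported` when every
-- point of `X` has points of `X` strictly on both sides of its line.
... | no _ | no ∄a = contradiction (empty⇒LC {X = X} λ x∈X → ∄a (_ , x∈X)) ¬lc
... | no ∄one | yes (a , a∈X) = contradiction
  (Unsupported.lc em bpp {a} a∈X (λ { refl → O∉X a∈X })
    (λ x∈X → proj₁ (both x∈X)) (λ x∈X → proj₂ (both x∈X)))
  ¬lc
  where
  both : ∀ {x} → x ∈ X → _
  both {x} x∈X = ¬oneSided⇒both-sides em x (λ one → ∄one (_ , x∈X , one))
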